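{- Let $k\ge1$, let $(A,t)$ be a $\mathcal{C}_k$-algebra and let $M\subseteq A$ be a proper cyclic deductive system. The following are equivalent: (1) $M$ is maximal; (2) for every $a\notin M$ there exists $m\in M$ with $\bigwedge_{j=1}^{k}t^j(\triangle a)\wedge m=0$; (3) for all $a,b\in A$, if $\bigwedge_{j=1}^{k}t^j(\triangle a)\vee b\in M$, then $a\in M$ or $b\in M$; (4) for every $a\notin M$, $\sim\triangle\bigwedge_{j=1}^{k}t^j(a)\in M$; (5) for all $a,b\notin M$, $a\rightharpoondown b\in M$ and $b\rightharpoondown a\in M$.
   Context: A modal pseudocomplemented De Morgan algebra ($mpM$-algebra) is an algebra $\langle A,\wedge,\vee,\sim,{}^\ast,0,1\rangle$ such that $\langle A,\wedge,\vee,\sim,0,1\rangle$ is a De Morgan algebra (bounded distributive lattice with $\sim\sim x=x$, $\sim(x\vee y)=\sim x\wedge\sim y$), $x^\ast$ is the pseudocomplement of $x$, and $x\vee\sim x\le x\vee x^\ast$. Put $\nabla x=\sim(\sim x\wedge x^\ast)$, $\triangle x=\sim\nabla\sim x$. A $\mathcal{C}_k$-algebra ($k\ge1$) is a pair $(A,t)$ with $A$ an $mpM$-algebra and $t$ an $mpM$-automorphism of $A$ with $t^k=\mathrm{id}$. The cyclic implication is $a\rightharpoondown b=\bigvee_{i=1}^{k}\nabla(\sim t^i(a))\vee b$. A cyclic deductive system is a set $D\subseteq A$ with $1\in D$ such that $x,\,x\rightharpoondown y\in D$ imply $y\in D$; it is maximal if it is maximal among proper cyclic deductive systems. -}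

module Defs where

open import Algebra.Core using (Op₁; Op₂)
open import Algebra.Lattice.Bundles using (RawLattice)
open import Algebra.Lattice.Morphism.Structures using (IsLatticeIsomorphism)
open import Data.Fin.Base using (toℕ)
open import Data.Nat.Base using (ℕ; suc)
open import Data.Nat.GeneralisedArithmetic using (fold)
open import Data.Product.Base using (_×_)
open import Data.Vec.Functional using (foldr)
open import Level using (Level; _⊔_) renaming (suc to lsuc)
open import Relation.Binary.Core using (Rel)
open import Relation.Binary.Definitions using (_Respects_)
open import Relation.Nullary.Negation.Core using (¬_)
open import Relation.Unary using (Pred; _∈_; _⊆_; Universal)
import Algebra.Definitions as AlgebraDefinitions
import Algebra.Lattice.Structures as LatticeStructures
import Relation.Binary.Construct.NaturalOrder.Left as LeftNaturalOrder

module _ {c ℓ : Level} {A : Set c} (_≈_ : Rel A ℓ) where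

  open AlgebraDefinitions _≈_ using (Identity; Congruent₁)
  open LatticeStructures _≈_ using (IsDistributiveLattice)

  record IsDeMorganAlgebra (_∧_ _∨_ : Op₂ A) (∼_ : Op₁ A) (𝟘 𝟙 : A) : Set (c ⊔ ℓ) where
    field
      isDistributiveLattice : IsDistributiveLattice _∨_ _∧_
      ∨-identity            : Identity 𝟘 _∨_
      ∧-identity            : Identity 𝟙 _∧_
      ∼-cong                : Congruent₁ ∼_
      ∼-involutive          : ∀ x → (∼ (∼ x)) ≈ x
      ∼-∨                   : ∀ x y → (∼ (x ∨ y)) ≈ ((∼ x) ∧ (∼ y))

    open IsDistributiveLattice isDistributiveLattice public

  record IsMpMAlgebra (_∧_ _∨_ : Op₂ A) (∼_ _* : Op₁ A) (𝟘 𝟙 : A) : Set (c ⊔ ℓ) where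
    open LeftNaturalOrder _≈_ _∧_ using (_≤_)
    field
      isDeMorganAlgebra : IsDeMorganAlgebra _∧_ _∨_ ∼_ 𝟘 𝟙
      -- x * is the largest y with x ∧ y ≈ 𝟘.
      *-disjoint        : ∀ x → (x ∧ (x *)) ≈ 𝟘
      *-greatest        : ∀ x y → (x ∧ y) ≈ 𝟘 → y ≤ (x *)
      ∨-∼≤∨-*           : ∀ x → (x ∨ (∼ x)) ≤ (x ∨ (x *))

    open IsDeMorganAlgebra isDeMorganAlgebra public

record MpMAlgebra (c ℓ : Level) : Set (lsuc (c ⊔ ℓ)) where
  infix  9 _*
  infix  8 ∼_ ∇_ △_
  infixr 7 _∧_
  infixr 6 _∨_
  infix  4 _≈_
  field
    Carrier      : Set c
    _≈_          : Rel Carrier ℓ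
    _∧_ _∨_      : Op₂ Carrier
    ∼_ _*        : Op₁ Carrier
    𝟘 𝟙          : Carrier
    isMpMAlgebra : IsMpMAlgebra _≈_ _∧_ _∨_ ∼_ _* 𝟘 𝟙

  open IsMpMAlgebra isMpMAlgebra public
  open LeftNaturalOrder _≈_ _∧_ public using (_≤_)

  rawLattice : RawLattice c ℓ
  rawLattice = record { _≈_ = _≈_ ; _∧_ = _∧_ ; _∨_ = _∨_ }

  ∇_ : Op₁ Carrier
  ∇ x = ∼ (∼ x ∧ x *)

  △_ : Op₁ Carrier
  △ x = ∼ (∇ (∼ x))

record IsMpMAutomorphism {c ℓ} (𝑨 : MpMAlgebra c ℓ)
                         (t : MpMAlgebra.Carrier 𝑨 → MpMAlgebra.Carrier 𝑨) : Set (c ⊔ ℓ) where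
  open MpMAlgebra 𝑨
  field
    isLatticeIsomorphism : IsLatticeIsomorphism rawLattice rawLattice t
    ∼-homo               : ∀ x → t (∼ x) ≈ ∼ t x
    *-homo               : ∀ x → t (x *) ≈ (t x) *
    𝟘-homo               : t 𝟘 ≈ 𝟘
    𝟙-homo               : t 𝟙 ≈ 𝟙

  open IsLatticeIsomorphism isLatticeIsomorphism public

-- The requirement k ≥ 1 is not built in; it is to be assumed where the record is used.
record CyclicAlgebra (k : ℕ) (c ℓ : Level) : Set (lsuc (c ⊔ ℓ)) where
  field
    mpMAlgebra : MpMAlgebra c ℓ

  open MpMAlgebra mpMAlgebra public

  field
    t                 : Carrier → Carrier
    isMpMAutomorphism : IsMpMAutomorphism mpMAlgebra t

  t^ : ℕ → Carrier → Carrier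
  t^ n x = fold x t n

  field
    t^k≈id : ∀ x → t^ k x ≈ x

  -- The joins and meets of f 1, …, f k: the index i : Fin k stands for 1 + toℕ i.
  ⋁₁ᵏ : (ℕ → Carrier) → Carrier
  ⋁₁ᵏ f = foldr _∨_ 𝟘 {k} (λ i → f (suc (toℕ i)))

  ⋀₁ᵏ : (ℕ → Carrier) → Carrier
  ⋀₁ᵏ f = foldr _∧_ 𝟙 {k} (λ i → f (suc (toℕ i)))

  infixr 5 _⇁_
  _⇁_ : Op₂ Carrier
  a ⇁ b = ⋁₁ᵏ (λ i → ∇ (∼ t^ i a)) ∨ b

  record IsCyclicDeductiveSystem {p} (D : Pred Carrier p) : Set (c ⊔ ℓ ⊔ p) where
    field
      -- D is a subset of the algebra considered up to its equality _≈_.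
      resp-≈       : D Respects _≈_
      𝟙∈           : 𝟙 ∈ D
      modus-ponens : ∀ {x y} → x ∈ D → (x ⇁ y) ∈ D → y ∈ D

  Proper : ∀ {p} → Pred Carrier p → Set (c ⊔ p)
  Proper D = ¬ Universal D

  IsProperCyclicDeductiveSystem : ∀ {p} → Pred Carrier p → Set (c ⊔ ℓ ⊔ p)
  IsProperCyclicDeductiveSystem D = IsCyclicDeductiveSystem D × Proper D

  record IsMaximalCyclicDeductiveSystem {p} (M : Pred Carrier p) : Set (c ⊔ ℓ ⊔ lsuc p) where
    field
      isProper : IsProperCyclicDeductiveSystem M
      maximal  : ∀ (D : Pred Carrier p) → IsProperCyclicDeductiveSystem D → M ⊆ D → D ⊆ M

{-# OPTIONS --safe #-}

-- Write N a = ⋀ⱼ tʲ(△ a) and call x crisp when x ∧ ∼x = 0.  The axiom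
-- x ∨ ∼x ≤ x ∨ x* makes every △ x crisp, so N a is the greatest crisp
-- t-invariant element below a, and ∼ N a is its Boolean complement.  As
-- a ⇁ b = ∼ N a ∨ b, the cyclic deductive systems are the filters closed
-- under N.  Each of (1)–(5) is then equivalent to
-- "a ∉ M implies ∼ N a ∈ M"; for (1), the system generated by M and a is
-- {x ∣ ∼ N a ∨ x ∈ M}, which is improper iff ∼ N a ∈ M.
module Submission where

open import Defs
open import Axiom.ExcludedMiddle using (ExcludedMiddle)
open import Data.Empty using (⊥-elim)
open import Data.Fin.Base using (Fin; zero; suc; toℕ; fromℕ<)
open import Data.Fin.Properties using (toℕ-fromℕ<; toℕ<n)
open import Data.Nat.Base using (ℕ; zero; suc; _<_; z<s) renaming (_≤_ to _≤ℕ_)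
open import Data.Nat.Properties using (m≤n⇒m<n∨m≡n; n<1+n)
open import Data.Product.Base using (_×_; ∃-syntax; _,_; proj₁; proj₂)
open import Data.Sum.Base using (_⊎_; inj₁; inj₂; [_,_]′)
open import Data.Vec.Functional using (foldr)
open import Function.Base using (_∘_; id)
open import Function.Bundles using (_⇔_; mk⇔)
open import Level using (Level; _⊔_)
open import Relation.Binary.PropositionalEquality.Core as ≡ using (_≡_; subst)
open import Relation.Nullary.Decidable.Core using (yes; no)
open import Relation.Unary using (Pred; _∈_; _∉_)
import Algebra.Lattice.Properties.Lattice as LatticeProperties
import Relation.Binary.Lattice as OrderTheory
import Relation.Binary.Lattice.Properties.JoinSemilattice as JoinSemilatticeProperties
import Relation.Binary.Lattice.Properties.MeetSemilattice as MeetSemilatticeProperties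
import Relation.Binary.Reasoning.PartialOrder as PartialOrderReasoning

-- Order laws, De Morgan laws and the operator `△`.

module MpMAlgebraProperties {c ℓ : Level} (𝑨 : MpMAlgebra c ℓ) where

  open MpMAlgebra 𝑨

  private
    orderTheoreticLattice : OrderTheory.Lattice c ℓ ℓ
    orderTheoreticLattice =
      LatticeProperties.∨-∧-orderTheoreticLattice (record { isLattice = isLattice })

  open OrderTheory.Lattice orderTheoreticLattice public
    using (poset; joinSemilattice; meetSemilattice; antisym; x≤x∨y; y≤x∨y; ∨-least; x∧y≤x; x∧y≤y; ∧-greatest)
    renaming (refl to ≤-refl; reflexive to ≤-reflexive; trans to ≤-trans)
  open JoinSemilatticeProperties joinSemilattice public using (∨-monotonic)
  open MeetSemilatticeProperties meetSemilattice public using (∧-monotonic)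
  open PartialOrderReasoning poset

  x≤𝟙 : ∀ x → x ≤ 𝟙
  x≤𝟙 x = sym (proj₂ ∧-identity x)

  𝟘≤x : ∀ x → 𝟘 ≤ x
  𝟘≤x x = ≤-trans (x≤x∨y 𝟘 x) (≤-reflexive (proj₁ ∨-identity x))

  ∼-antitone : ∀ {x y} → x ≤ y → ∼ y ≤ ∼ x
  ∼-antitone {x} {y} x≤y = begin
    ∼ y          ≈⟨ ∼-cong (antisym (y≤x∨y x y) (∨-least x≤y ≤-refl)) ⟩
    ∼ (x ∨ y)    ≈⟨ ∼-∨ x y ⟩
    ∼ x ∧ ∼ y    ≤⟨ x∧y≤x (∼ x) (∼ y) ⟩
    ∼ x          ∎

  ∼-cancel-≤ : ∀ {x y} → ∼ x ≤ ∼ y → y ≤ x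
  ∼-cancel-≤ {x} {y} ∼x≤∼y = begin
    y        ≈⟨ ∼-involutive y ⟨
    ∼ ∼ y    ≤⟨ ∼-antitone ∼x≤∼y ⟩
    ∼ ∼ x    ≈⟨ ∼-involutive x ⟩
    x        ∎

  ∼-∧ : ∀ x y → ∼ (x ∧ y) ≈ ∼ x ∨ ∼ y
  ∼-∧ x y = begin-equality
    ∼ (x ∧ y)            ≈⟨ ∼-cong (∧-cong (∼-involutive x) (∼-involutive y)) ⟨
    ∼ (∼ ∼ x ∧ ∼ ∼ y)    ≈⟨ ∼-cong (∼-∨ (∼ x) (∼ y)) ⟨
    ∼ ∼ (∼ x ∨ ∼ y)      ≈⟨ ∼-involutive _ ⟩
    ∼ x ∨ ∼ y            ∎

  ∼𝟙≈𝟘 : ∼ 𝟙 ≈ 𝟘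
  ∼𝟙≈𝟘 = antisym (∼-cancel-≤ (≤-trans (x≤𝟙 _) (≤-reflexive (sym (∼-involutive 𝟙))))) (𝟘≤x _)

  *-antitone : ∀ {x y} → x ≤ y → y * ≤ x *
  *-antitone {x} {y} x≤y = *-greatest x (y *) (antisym
    (≤-trans (∧-monotonic x≤y ≤-refl) (≤-reflexive (*-disjoint y)))
    (𝟘≤x _))

  △-unfold : ∀ x → △ x ≈ x ∧ (∼ x) *
  △-unfold x = trans (∼-involutive _) (∧-cong (∼-involutive x) refl)

  △x≤x : ∀ x → △ x ≤ x
  △x≤x x = ≤-trans (≤-reflexive (△-unfold x)) (x∧y≤x _ _)

  △-monotone : ∀ {x y} → x ≤ y → △ x ≤ △ y
  △-monotone {x} {y} x≤y = begin
    △ x            ≈⟨ △-unfold x ⟩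
    x ∧ (∼ x) *    ≤⟨ ∧-monotonic x≤y (*-antitone (∼-antitone x≤y)) ⟩
    y ∧ (∼ y) *    ≈⟨ △-unfold y ⟨
    △ y            ∎

  -- Crisp elements.

  Crisp : Carrier → Set ℓ
  Crisp x = x ∧ ∼ x ≤ 𝟘

  crisp-resp-≈ : ∀ {x y} → x ≈ y → Crisp x → Crisp y
  crisp-resp-≈ x≈y = ≤-trans (≤-reflexive (sym (∧-cong x≈y (∼-cong x≈y))))

  crisp-𝟙 : Crisp 𝟙
  crisp-𝟙 = ≤-trans (x∧y≤y _ _) (≤-reflexive ∼𝟙≈𝟘)

  crisp-∧ : ∀ {x y} → Crisp x → Crisp y → Crisp (x ∧ y)
  crisp-∧ {x} {y} cx cy = begin
    (x ∧ y) ∧ ∼ (x ∧ y)                ≈⟨ ∧-cong refl (∼-∧ x y) ⟩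
    (x ∧ y) ∧ (∼ x ∨ ∼ y)              ≈⟨ ∧-distribˡ-∨ _ _ _ ⟩
    (x ∧ y) ∧ ∼ x ∨ (x ∧ y) ∧ ∼ y      ≤⟨ ∨-least
      (≤-trans (∧-monotonic (x∧y≤x x y) ≤-refl) cx)
      (≤-trans (∧-monotonic (x∧y≤y x y) ≤-refl) cy) ⟩
    𝟘                                  ∎

  -- Negating the axiom `∨-∼≤∨-*` yields `∼ x ∧ ∼ (x *) ≤ x`. Hence, after distributing, both
  -- joinands of `w ∧ ∼ w` lie below `x` as well as below `x *`, and these two are disjoint.
  crisp-∼x∧x* : ∀ x → Crisp (∼ x ∧ x *)
  crisp-∼x∧x* x = begin
    w ∧ ∼ w                          ≈⟨ ∧-cong refl (∼-∧ _ _) ⟩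
    w ∧ (∼ ∼ x ∨ ∼ (x *))            ≈⟨ ∧-distribˡ-∨ _ _ _ ⟩
    w ∧ ∼ ∼ x ∨ w ∧ ∼ (x *)          ≤⟨ ∨-least
      (∧-greatest (≤-trans (x∧y≤y _ _) (≤-reflexive (∼-involutive x))) w∧z≤x*)
      (∧-greatest (≤-trans (∧-monotonic (x∧y≤x _ _) ≤-refl) ∼x∧∼x*≤x) w∧z≤x*) ⟩
    x ∧ x *                          ≈⟨ *-disjoint x ⟩
    𝟘                                ∎
    where
    w = ∼ x ∧ x *
    w∧z≤x* : ∀ {z} → w ∧ z ≤ x *
    w∧z≤x* = ≤-trans (x∧y≤x _ _) (x∧y≤y _ _)
    ∼x∧∼x*≤x : ∼ x ∧ ∼ (x *) ≤ x
    ∼x∧∼x*≤x = begin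
      ∼ x ∧ ∼ (x *)    ≈⟨ ∼-∨ x (x *) ⟨
      ∼ (x ∨ x *)      ≤⟨ ∼-antitone (∨-∼≤∨-* x) ⟩
      ∼ (x ∨ ∼ x)      ≤⟨ ∼-antitone (y≤x∨y x (∼ x)) ⟩
      ∼ ∼ x            ≈⟨ ∼-involutive x ⟩
      x                ∎

  crisp-△ : ∀ x → Crisp (△ x)
  crisp-△ x = crisp-resp-≈ (sym (∼-involutive _)) (crisp-∼x∧x* (∼ x))

  -- An element disjoint from `∼ x` lies below `(∼ x) *`, the second factor of `△ x`. Together with
  -- `△x≤x` this makes crisp elements fixed points of `△`.
  crisp⇒x≤△x : ∀ {x} → Crisp x → x ≤ △ x
  crisp⇒x≤△x {x} cx = ≤-trans
    (∧-greatest ≤-refl (*-greatest (∼ x) x (trans (∧-comm _ _) (antisym cx (𝟘≤x _)))))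
    (≤-reflexive (sym (△-unfold x)))

  crisp⇒𝟙≤∼x∨x : ∀ {x} → Crisp x → 𝟙 ≤ ∼ x ∨ x
  crisp⇒𝟙≤∼x∨x {x} cx = ∼-cancel-≤ (begin
    ∼ (∼ x ∨ x)    ≈⟨ ∼-∨ (∼ x) x ⟩
    ∼ ∼ x ∧ ∼ x    ≈⟨ ∧-cong (∼-involutive x) refl ⟩
    x ∧ ∼ x        ≤⟨ cx ⟩
    𝟘              ≤⟨ 𝟘≤x _ ⟩
    ∼ 𝟙            ∎)

  -- One half of the Boolean adjunction between `z ∧_` and `∼ z ∨_`, resting on excluded middle for
  -- `z`; the other half, `crisp-residualˡ`, rests on `z ∧ ∼ z ≤ 𝟘`.
  crisp-residualʳ : ∀ {z} → Crisp z → ∀ {x y} → z ∧ x ≤ y → x ≤ ∼ z ∨ y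
  crisp-residualʳ {z} cz {x} {y} z∧x≤y = begin
    x                    ≤⟨ ∧-greatest ≤-refl (≤-trans (x≤𝟙 x) (crisp⇒𝟙≤∼x∨x cz)) ⟩
    x ∧ (∼ z ∨ z)        ≈⟨ ∧-distribˡ-∨ _ _ _ ⟩
    x ∧ ∼ z ∨ x ∧ z      ≤⟨ ∨-monotonic (x∧y≤y _ _) (≤-trans (≤-reflexive (∧-comm x z)) z∧x≤y) ⟩
    ∼ z ∨ y              ∎

  crisp-residualˡ : ∀ {z} → Crisp z → ∀ {x y} → x ≤ ∼ z ∨ y → z ∧ x ≤ y
  crisp-residualˡ {z} cz {x} {y} x≤∼z∨y = begin
    z ∧ x                ≤⟨ ∧-monotonic ≤-refl x≤∼z∨y ⟩
    z ∧ (∼ z ∨ y)        ≈⟨ ∧-distribˡ-∨ _ _ _ ⟩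
    z ∧ ∼ z ∨ z ∧ y      ≤⟨ ∨-least (≤-trans cz (𝟘≤x y)) (x∧y≤y z y) ⟩
    y                    ∎

  -- Finite meets and joins.

  ⋀ ⋁ : ∀ {n} → (Fin n → Carrier) → Carrier
  ⋀ = foldr _∧_ 𝟙
  ⋁ = foldr _∨_ 𝟘

  ⋀-lower : ∀ {n} (f : Fin n → Carrier) i → ⋀ f ≤ f i
  ⋀-lower f zero    = x∧y≤x _ _
  ⋀-lower f (suc i) = ≤-trans (x∧y≤y _ _) (⋀-lower (f ∘ suc) i)

  ⋀-greatest : ∀ {n} (f : Fin n → Carrier) {x} → (∀ i → x ≤ f i) → x ≤ ⋀ f
  ⋀-greatest {zero}  f x≤f = x≤𝟙 _
  ⋀-greatest {suc n} f x≤f = ∧-greatest (x≤f zero) (⋀-greatest (f ∘ suc) (x≤f ∘ suc))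

  crisp-⋀ : ∀ {n} (f : Fin n → Carrier) → (∀ i → Crisp (f i)) → Crisp (⋀ f)
  crisp-⋀ {zero}  f cf = crisp-𝟙
  crisp-⋀ {suc n} f cf = crisp-∧ (cf zero) (crisp-⋀ (f ∘ suc) (cf ∘ suc))

  ⋁≈∼⋀ : ∀ {n} (f g : Fin n → Carrier) → (∀ i → f i ≈ ∼ g i) → ⋁ f ≈ ∼ ⋀ g
  ⋁≈∼⋀ {zero}  f g f≈∼g = antisym (𝟘≤x _) (≤-reflexive ∼𝟙≈𝟘)
  ⋁≈∼⋀ {suc n} f g f≈∼g =
    trans (∨-cong (f≈∼g zero) (⋁≈∼⋀ (f ∘ suc) (g ∘ suc) (f≈∼g ∘ suc))) (sym (∼-∧ _ _))

-- The automorphism and the operator `N`.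

module CyclicAlgebraProperties {k′ : ℕ} {c ℓ : Level} (𝑨 : CyclicAlgebra (suc k′) c ℓ) where

  open CyclicAlgebra 𝑨
  open MpMAlgebraProperties mpMAlgebra
  open IsMpMAutomorphism isMpMAutomorphism
    using (∼-homo; *-homo; 𝟙-homo) renaming (∧-homo to t-∧; ⟦⟧-cong to t-cong)
  open PartialOrderReasoning poset

  private
    k = suc k′

  t-monotone : ∀ {x y} → x ≤ y → t x ≤ t y
  t-monotone {x} {y} x≤y = trans (t-cong x≤y) (t-∧ x y)

  t^-monotone : ∀ n {x y} → x ≤ y → t^ n x ≤ t^ n y
  t^-monotone zero    x≤y = x≤y
  t^-monotone (suc n) x≤y = t-monotone (t^-monotone n x≤y)

  t-△ : ∀ x → t (△ x) ≈ △ t x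
  t-△ x = begin-equality
    t (△ x)                ≈⟨ t-cong (△-unfold x) ⟩
    t (x ∧ (∼ x) *)        ≈⟨ t-∧ _ _ ⟩
    t x ∧ t ((∼ x) *)      ≈⟨ ∧-cong refl (*-homo (∼ x)) ⟩
    t x ∧ (t (∼ x)) *      ≈⟨ ∧-cong refl (antisym
      (*-antitone (≤-reflexive (sym (∼-homo x)))) (*-antitone (≤-reflexive (∼-homo x)))) ⟩
    t x ∧ (∼ t x) *        ≈⟨ △-unfold (t x) ⟨
    △ t x                  ∎

  t^-△ : ∀ n x → t^ n (△ x) ≈ △ (t^ n x)
  t^-△ zero    x = refl
  t^-△ (suc n) x = trans (t-cong (t^-△ n x)) (t-△ (t^ n x))

  ≤t⋀ : ∀ {n} (f : Fin n → Carrier) {x} → (∀ i → x ≤ t (f i)) → x ≤ t (⋀ f)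
  ≤t⋀ {zero}  f x≤tf = ≤-trans (x≤𝟙 _) (≤-reflexive (sym 𝟙-homo))
  ≤t⋀ {suc n} f x≤tf = ≤-trans
    (∧-greatest (x≤tf zero) (≤t⋀ (f ∘ suc) (x≤tf ∘ suc)))
    (≤-reflexive (sym (t-∧ _ _)))

  ⋀₁ᵏ-lower : ∀ (f : ℕ → Carrier) {n} → n < k → ⋀₁ᵏ f ≤ f (suc n)
  ⋀₁ᵏ-lower f n<k = subst (λ m → ⋀₁ᵏ f ≤ f (suc m)) (toℕ-fromℕ< n<k)
    (⋀-lower (λ i → f (suc (toℕ i))) (fromℕ< n<k))

  N : Carrier → Carrier
  N a = ⋀₁ᵏ (λ j → t^ j (△ a))

  crisp-N : ∀ a → Crisp (N a)
  crisp-N a = crisp-⋀ {k} _ (λ i → crisp-resp-≈ (sym (t^-△ (suc (toℕ i)) a)) (crisp-△ _))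

  Na≤a : ∀ a → N a ≤ a
  Na≤a a = begin
    -- Index `k′` selects the last conjunct, with exponent `k`, which exists because `k` is a
    -- successor.
    N a          ≤⟨ ⋀₁ᵏ-lower (λ j → t^ j (△ a)) (n<1+n k′) ⟩
    t^ k (△ a)   ≈⟨ t^k≈id (△ a) ⟩
    △ a          ≤⟨ △x≤x a ⟩
    a            ∎

  -- Applying `t` shifts the conjuncts cyclically: exponent `n < k` moves to `suc n`, and exponent
  -- `k` wraps around to the first conjunct since `t^ k` is the identity.
  Na≤tNa : ∀ a → N a ≤ t (N a)
  Na≤tNa a = ≤t⋀ {k} _ (λ i → shift (m≤n⇒m<n∨m≡n (toℕ<n i)))
    where
    shift : ∀ {n} → (n < k) ⊎ (n ≡ k) → N a ≤ t (t^ n (△ a))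
    shift (inj₁ n<k)    = ⋀₁ᵏ-lower (λ j → t^ j (△ a)) n<k
    shift (inj₂ ≡.refl) = ≤-trans (⋀₁ᵏ-lower (λ j → t^ j (△ a)) z<s)
                                  (≤-reflexive (t-cong (sym (t^k≈id (△ a)))))

  -- Crispness gives `u ≤ △ u ≤ △ a`, and `u ≤ t u` iterates to `u ≤ t^ n u`, so `u` lies below
  -- every conjunct.
  N-greatest : ∀ {u a} → Crisp u → u ≤ t u → u ≤ a → u ≤ N a
  N-greatest {u} {a} cu u≤tu u≤a = ⋀-greatest {k} _ (λ i → ≤-trans
    (u≤t^u (suc (toℕ i)))
    (t^-monotone (suc (toℕ i)) (≤-trans (crisp⇒x≤△x cu) (△-monotone u≤a))))
    where
    u≤t^u : ∀ n → u ≤ t^ n u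
    u≤t^u zero    = ≤-refl
    u≤t^u (suc n) = ≤-trans u≤tu (t-monotone (u≤t^u n))

  -- The normality axiom □(p → x) → (□p → □x) for N as a modal box, with p = N a.
  Na∧N[∼Na∨x]≤Nx : ∀ a x → N a ∧ N (∼ N a ∨ x) ≤ N x
  Na∧N[∼Na∨x]≤Nx a x = N-greatest
    (crisp-∧ (crisp-N a) (crisp-N _))
    (≤-trans (∧-monotonic (Na≤tNa a) (Na≤tNa _)) (≤-reflexive (sym (t-∧ _ _))))
    (crisp-residualˡ (crisp-N a) (Na≤a _))

  -- For the upper bound, `△` is monotone and commutes with powers of `t`. For the lower bound,
  -- `N a` is crisp, hence below its own `△`, and lies under every `t^ j a`.
  △⋀t^≈N : ∀ a → △ ⋀₁ᵏ (λ j → t^ j a) ≈ N a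
  △⋀t^≈N a = antisym
    (⋀-greatest {k} _ (λ i → ≤-trans
      (△-monotone (⋀-lower {k} (λ i → t^ (suc (toℕ i)) a) i))
      (≤-reflexive (sym (t^-△ (suc (toℕ i)) a)))))
    (≤-trans (crisp⇒x≤△x (crisp-N a)) (△-monotone (⋀-greatest {k} _ (λ i → ≤-trans
      (⋀-lower {k} (λ i → t^ (suc (toℕ i)) (△ a)) i)
      (t^-monotone (suc (toℕ i)) (△x≤x a))))))

  -- Up to double negation `∇ (∼ y)` is `∼ △ y`, so De Morgan turns the join into `∼ N a`.
  ⇁-unfold : ∀ a b → (a ⇁ b) ≈ ∼ N a ∨ b
  ⇁-unfold a b = ∨-cong (⋁≈∼⋀ {k} _ _ (λ i → sym (trans
    (∼-cong (t^-△ (suc (toℕ i)) a)) (∼-involutive _)))) refl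

  -- Cyclic deductive systems as `N`-closed filters.

  module CyclicDeductiveSystemProperties
    {p : Level} {D : Pred Carrier p} (isCDS : IsCyclicDeductiveSystem D) where

    open IsCyclicDeductiveSystem isCDS

    -- If `N x ≤ y`, residuation makes `x ⇁ y` equal to `𝟙`. Both upward closure and `N`-closure are
    -- instances.
    detach : ∀ {x y} → x ∈ D → N x ≤ y → y ∈ D
    detach {x} {y} x∈D Nx≤y = modus-ponens x∈D (resp-≈ 𝟙≈x⇁y 𝟙∈)
      where
      𝟙≈x⇁y : 𝟙 ≈ (x ⇁ y)
      𝟙≈x⇁y = antisym
        (≤-trans (crisp-residualʳ (crisp-N x) (≤-trans (x∧y≤x _ _) Nx≤y))
                 (≤-reflexive (sym (⇁-unfold x y))))
        (x≤𝟙 _)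

    upward : ∀ {x y} → x ∈ D → x ≤ y → y ∈ D
    upward x∈D x≤y = detach x∈D (≤-trans (Na≤a _) x≤y)

    N-closed : ∀ {x} → x ∈ D → N x ∈ D
    N-closed x∈D = detach x∈D ≤-refl

    -- Since `N x ∧ y ≤ x ∧ y`, residuation puts `y` below `x ⇁ (x ∧ y)`.
    ∧-closed : ∀ {x y} → x ∈ D → y ∈ D → x ∧ y ∈ D
    ∧-closed {x} {y} x∈D y∈D = modus-ponens x∈D (upward y∈D (≤-trans
      (crisp-residualʳ (crisp-N x) (∧-monotonic (Na≤a x) ≤-refl))
      (≤-reflexive (sym (⇁-unfold x (x ∧ y))))))

    x∈D∧∼Nx∈D⇒𝟘∈D : ∀ {x} → x ∈ D → ∼ N x ∈ D → 𝟘 ∈ D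
    x∈D∧∼Nx∈D⇒𝟘∈D {x} x∈D ∼Nx∈D = upward (∧-closed (N-closed x∈D) ∼Nx∈D) (crisp-N x)

    -- Membership is a single instance of membership in `D`, so the predicate stays at level `p`,
    -- the level over which maximality quantifies.
    adjoin : Carrier → Pred Carrier p
    adjoin a x = ∼ N a ∨ x ∈ D

    adjoin-isCDS : ∀ a → IsCyclicDeductiveSystem (adjoin a)
    adjoin-isCDS a = record
      { resp-≈       = λ x≈y → resp-≈ (∨-cong refl x≈y)
      ; 𝟙∈           = upward 𝟙∈ (y≤x∨y _ _)
      ; modus-ponens = mp
      }
      where
      mp : ∀ {x y} → x ∈ adjoin a → (x ⇁ y) ∈ adjoin a → y ∈ adjoin a
      -- Under the assumption `N a`, normality extracts `N x`, residuation extracts `x ⇁ y`, and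
      -- these two together yield `y`.
      mp {x} {y} x∈ x⇁y∈ = upward (∧-closed (N-closed x∈) x⇁y∈)
        (crisp-residualʳ (crisp-N a) (begin
          N a ∧ N (∼ N a ∨ x) ∧ (∼ N a ∨ (x ⇁ y))
            ≤⟨ ∧-greatest
                 (≤-trans (∧-monotonic ≤-refl (x∧y≤x _ _)) (Na∧N[∼Na∨x]≤Nx a x))
                 (crisp-residualˡ (crisp-N a) (x∧y≤y _ _)) ⟩
          N x ∧ (x ⇁ y)
            ≤⟨ crisp-residualˡ (crisp-N x) (≤-reflexive (⇁-unfold x y)) ⟩
          y ∎))

  -- The characterisations of maximality.

  module MaximalityCriteria
    {p : Level} (em : ExcludedMiddle p)
    (M : Pred Carrier p) (isProperCDS : IsProperCyclicDeductiveSystem M) where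

    private
      isCDS = proj₁ isProperCDS
      module M = CyclicDeductiveSystemProperties isCDS
    open IsCyclicDeductiveSystem isCDS using (resp-≈; 𝟙∈)

    Complementing : Set (c ⊔ p)
    Complementing = ∀ a → a ∉ M → ∼ N a ∈ M

    𝟘∉M : 𝟘 ∉ M
    𝟘∉M 𝟘∈M = proj₂ isProperCDS (λ x → M.upward 𝟘∈M (𝟘≤x x))

    -- If `𝟘` is in the extension by `a`, that is already the claim up to `∨-identity`; otherwise
    -- the extension is proper and maximality forces `a ∈ M`.
    maximal⇒complementing : IsMaximalCyclicDeductiveSystem M → Complementing
    maximal⇒complementing max a a∉M with em {M.adjoin a 𝟘}
    ... | yes 𝟘∈adjoin = resp-≈ (proj₂ ∨-identity _) 𝟘∈adjoin
    ... | no  𝟘∉adjoin = ⊥-elim (a∉M (maximal (M.adjoin a)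
        (M.adjoin-isCDS a , λ universal → 𝟘∉adjoin (universal 𝟘))
        (λ x∈M → M.upward x∈M (y≤x∨y _ _))
        (M.upward 𝟙∈ (crisp-residualʳ (crisp-N a) (≤-trans (x∧y≤x _ _) (Na≤a a))))))
      where open IsMaximalCyclicDeductiveSystem max

    -- A larger system with some `x ∉ M` would contain both `x` and `∼ N x`, hence `𝟘`.
    complementing⇒maximal : Complementing → IsMaximalCyclicDeductiveSystem M
    complementing⇒maximal comp = record { isProper = isProperCDS ; maximal = maximal }
      where
      maximal : ∀ D → IsProperCyclicDeductiveSystem D → (∀ {x} → x ∈ M → x ∈ D) → ∀ {x} → x ∈ D → x ∈ M
      maximal D (isCDS-D , proper) M⊆D {x} x∈D with em {x ∈ M}
      ... | yes x∈M = x∈M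
      ... | no  x∉M = ⊥-elim (proper (λ y →
          D.upward (D.x∈D∧∼Nx∈D⇒𝟘∈D x∈D (M⊆D (comp x x∉M))) (𝟘≤x y)))
        where module D = CyclicDeductiveSystemProperties isCDS-D

    maximal⇔ : ∀ {q} {P : Set q} → (Complementing → P) → (P → Complementing) →
               IsMaximalCyclicDeductiveSystem M ⇔ P
    maximal⇔ to from = mk⇔ (to ∘ maximal⇒complementing) (complementing⇒maximal ∘ from)

    maximal⇔disjoint : IsMaximalCyclicDeductiveSystem M ⇔
      (∀ a → a ∉ M → ∃[ m ] (m ∈ M × (N a ∧ m) ≈ 𝟘))
    maximal⇔disjoint = maximal⇔
      (λ comp a a∉M → ∼ N a , comp a a∉M , antisym (crisp-N a) (𝟘≤x _))
      -- Disjointness from the crisp `N a` forces `m ≤ ∼ N a`.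
      (λ disj a a∉M → let m , m∈M , Na∧m≈𝟘 = disj a a∉M in
        M.upward m∈M (≤-trans (crisp-residualʳ (crisp-N a) (≤-reflexive Na∧m≈𝟘))
                              (≤-reflexive (proj₂ ∨-identity _))))

    maximal⇔prime : IsMaximalCyclicDeductiveSystem M ⇔
      (∀ a b → (N a ∨ b) ∈ M → a ∈ M ⊎ b ∈ M)
    maximal⇔prime = maximal⇔ to from
      where
      to : Complementing → ∀ a b → (N a ∨ b) ∈ M → a ∈ M ⊎ b ∈ M
      to comp a b Na∨b∈M with em {a ∈ M}
      ... | yes a∈M = inj₁ a∈M
      ... | no  a∉M = inj₂ (M.upward (M.∧-closed (comp a a∉M) Na∨b∈M) (begin
        ∼ N a ∧ (N a ∨ b)          ≈⟨ ∧-distribˡ-∨ _ _ _ ⟩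
        ∼ N a ∧ N a ∨ ∼ N a ∧ b    ≤⟨ ∨-least
          (≤-trans (≤-reflexive (∧-comm _ _)) (≤-trans (crisp-N a) (𝟘≤x b)))
          (x∧y≤y _ _) ⟩
        b                          ∎))
      from : (∀ a b → (N a ∨ b) ∈ M → a ∈ M ⊎ b ∈ M) → Complementing
      -- Primeness is applied with `b = ∼ N a`, where the join is `𝟙` by excluded middle for `N a`.
      from prime a a∉M = [ ⊥-elim ∘ a∉M , id ]′ (prime a (∼ N a)
        (M.upward 𝟙∈ (≤-trans (crisp⇒𝟙≤∼x∨x (crisp-N a)) (≤-reflexive (∨-comm _ _)))))

    maximal⇔∼△⋀ : IsMaximalCyclicDeductiveSystem M ⇔
      (∀ a → a ∉ M → (∼ (△ ⋀₁ᵏ (λ j → t^ j a))) ∈ M)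
    maximal⇔∼△⋀ = maximal⇔
      (λ comp a a∉M → resp-≈ (∼-cong (sym (△⋀t^≈N a))) (comp a a∉M))
      (λ h a a∉M → resp-≈ (∼-cong (△⋀t^≈N a)) (h a a∉M))

    maximal⇔⇁ : IsMaximalCyclicDeductiveSystem M ⇔
      (∀ a b → a ∉ M → b ∉ M → (a ⇁ b) ∈ M × (b ⇁ a) ∈ M)
    maximal⇔⇁ = maximal⇔
      (λ comp a b a∉M b∉M → ⇁-intro a b (comp a a∉M) , ⇁-intro b a (comp b b∉M))
      -- The choice `b = 𝟘` is allowed because `M` is proper, and `a ⇁ 𝟘` reduces to `∼ N a`.
      (λ h a a∉M → resp-≈ (trans (⇁-unfold a 𝟘) (proj₂ ∨-identity _)) (proj₁ (h a 𝟘 a∉M 𝟘∉M)))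
      where
      ⇁-intro : ∀ a b → ∼ N a ∈ M → (a ⇁ b) ∈ M
      ⇁-intro a b ∼Na∈M = M.upward ∼Na∈M
        (≤-trans (x≤x∨y _ _) (≤-reflexive (sym (⇁-unfold a b))))

theorem4p3 : {c ℓ p : Level} → ExcludedMiddle p →
    (k : ℕ) → 1 ≤ℕ k → (𝑨 : CyclicAlgebra k c ℓ) →
    let open CyclicAlgebra 𝑨 in
    (M : Pred Carrier p) → IsProperCyclicDeductiveSystem M →
    let
      ⟨1⟩ = IsMaximalCyclicDeductiveSystem M
      ⟨2⟩ = ∀ a → a ∉ M → ∃[ m ] (m ∈ M × (⋀₁ᵏ (λ j → t^ j (△ a)) ∧ m) ≈ 𝟘)
      ⟨3⟩ = ∀ a b → (⋀₁ᵏ (λ j → t^ j (△ a)) ∨ b) ∈ M → a ∈ M ⊎ b ∈ M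
      ⟨4⟩ = ∀ a → a ∉ M → (∼ (△ ⋀₁ᵏ (λ j → t^ j a))) ∈ M
      ⟨5⟩ = ∀ a b → a ∉ M → b ∉ M → (a ⇁ b) ∈ M × (b ⇁ a) ∈ M
    in
    (⟨1⟩ ⇔ ⟨2⟩) × (⟨1⟩ ⇔ ⟨3⟩) × (⟨1⟩ ⇔ ⟨4⟩) × (⟨1⟩ ⇔ ⟨5⟩)
theorem4p3 em (suc k) _ 𝑨 M isProperCDS =
  maximal⇔disjoint , maximal⇔prime , maximal⇔∼△⋀ , maximal⇔⇁
  where
  open CyclicAlgebraProperties 𝑨
  open MaximalityCriteria em M isProperCDS
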